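{- Let $K/F$ be a computable algebraic field extension for which the degree map $\deg_F:K\to\mathbb{N}$ is computable, and let $C\subseteq\omega$ be a cohesive set. Then $\prod_C K/\prod_C F$ is algebraic if and only if $\{\deg_F(\alpha)\mid\alpha\in K\}$ is bounded.
   Context: For $A,B\subseteq\omega$, $A\subseteq^* B$ means $A\setminus B$ is finite. A set $C\subseteq\omega$ is cohesive if it is infinite and for every c.e. set $W$ either $C\subseteq^*W$ or $C\subseteq^*\overline{W}$. A computable structure has computable domain $\subseteq\omega$ and computable atomic diagram. For a computable structure $\mathcal A$ and cohesive $C$, the cohesive power $\prod_C\mathcal A$ has as domain the classes $[\varphi]$ of partial computable functions $\varphi$ from $\omega$ to $\mathcal{A}$ with $C\subseteq^*\mathrm{dom}(\varphi)$, where $[\varphi]=[\psi]$ iff $C\subseteq^*\{i:\varphi(i){\downarrow}=\psi(i){\downarrow}\}$; functions and constants are interpreted pointwise. A computable field extension $K/F$ is a triple $(K,F,\Psi)$ with $K,F$ computable fields and $\Psi:F\to K$ a computable ring homomorphism; $F$ is identified with its image. $\prod_CF$ is regarded as a subfield of $\prod_CK$ via $[\alpha]\mapsto[\Psi\circ\alpha]$. For $\alpha\in K$ algebraic over $F$, $\deg_F(\alpha)=[F(\alpha):F]$ is the degree of its minimal polynomial. -}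

module Defs where

open import Algebra.Bundles.Raw using (RawRing)
open import Algebra.Morphism.Structures using (module RingMorphisms)
open import Algebra.Structures using (IsCommutativeRing)
open import Data.Empty using (⊥-elim)
open import Data.Fin.Base using (Fin; zero; suc)
open import Data.List.Base as List using (List; []; _∷_; _∷ʳ_; length)
open import Data.List.Relation.Unary.Any using (Any)
open import Data.Nat.Base as Nat using (ℕ; zero; suc; _≤_; _<_)
import Data.Nat.InfinitelyOften as InfinitelyOften
open import Data.Nat.Properties
  using ( <-cmp; <-irrefl; ≤-refl; ≤-trans; n≤1+n; m≤m+n; m≤m⊔n; m≤n⊔m; 0≢1+n; 1+n≢0
        ; +-comm; +-monoʳ-≤; +-mono-<-≤; +-cancelˡ-≡; *-mono-≤; module ≤-Reasoning)
open import Data.Product.Base using (Σ; ∃; ∃-syntax; _×_; _,_; proj₁; proj₂)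
open import Data.Sum.Base using (_⊎_; inj₁; inj₂)
open import Data.Vec.Base as Vec using (Vec; []; _∷_; lookup; tabulate)
open import Data.Vec.Properties using (tabulate∘lookup)
open import Function.Base using (_∘_; _on_)
open import Function.Bundles using (_⇔_)
open import Level using (Level; 0ℓ; _⊔_)
open import Relation.Binary.Definitions using (tri<; tri≈; tri>)
open import Relation.Binary.PropositionalEquality
  using (_≡_; refl; sym; trans; cong; cong₂; subst)
open import Relation.Nullary.Negation using (¬_)
open import Relation.Unary using (Pred; ∁; _∖_)

private
  variable
    m n : ℕ
    c ℓ c₁ ℓ₁ c₂ ℓ₂ : Level

-- Programs for the partial computable functions: Kleene's μ-recursive
-- functions. Primitive recursion is on the first argument, and mu searches
-- for the first argument.

data Rec : ℕ → Set where
  zero : Rec 0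
  suc  : Rec 1
  proj : Fin n → Rec n
  comp : Rec m → Vec (Rec n) m → Rec n
  prec : Rec n → Rec (suc (suc n)) → Rec (suc n)
  mu   : Rec (suc n) → Rec n

infix 4 _[_]⇓_ _[_]⇓*_

-- e [ xs ]⇓ y : the program e halts on input xs with output y.

data _[_]⇓_ : Rec n → Vec ℕ n → ℕ → Set
data _[_]⇓*_ : Vec (Rec n) m → Vec ℕ n → Vec ℕ m → Set

data _[_]⇓_ where
  zero  : zero [ [] ]⇓ 0
  suc   : ∀ {x} → suc [ x ∷ [] ]⇓ suc x
  proj  : ∀ {i : Fin n} {xs} → proj i [ xs ]⇓ lookup xs i
  comp  : ∀ {e : Rec m} {es : Vec (Rec n) m} {xs ys z} →
          es [ xs ]⇓* ys → e [ ys ]⇓ z → comp e es [ xs ]⇓ z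
  prec0 : ∀ {e : Rec n} {e′ xs y} →
          e [ xs ]⇓ y → prec e e′ [ 0 ∷ xs ]⇓ y
  precs : ∀ {e : Rec n} {e′ k xs r y} →
          prec e e′ [ k ∷ xs ]⇓ r → e′ [ k ∷ r ∷ xs ]⇓ y →
          prec e e′ [ suc k ∷ xs ]⇓ y
  mu    : ∀ {e : Rec (suc n)} {xs y} →
          e [ y ∷ xs ]⇓ 0 →
          (∀ z → z < y → ∃[ k ] e [ z ∷ xs ]⇓ suc k) →
          mu e [ xs ]⇓ y

data _[_]⇓*_ where
  []  : ∀ {xs : Vec ℕ n} → [] [ xs ]⇓* []
  _∷_ : ∀ {e : Rec n} {es : Vec (Rec n) m} {xs y ys} →
        e [ xs ]⇓ y → es [ xs ]⇓* ys → (e ∷ es) [ xs ]⇓* (y ∷ ys)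

mutual
  ⇓-deterministic : ∀ {e : Rec n} {xs y z} → e [ xs ]⇓ y → e [ xs ]⇓ z → y ≡ z
  ⇓-deterministic zero zero = refl
  ⇓-deterministic suc suc = refl
  ⇓-deterministic proj proj = refl
  ⇓-deterministic (comp ps p) (comp qs q)
    with refl ← ⇓*-deterministic ps qs = ⇓-deterministic p q
  ⇓-deterministic (prec0 p) (prec0 q) = ⇓-deterministic p q
  ⇓-deterministic (precs p p′) (precs q q′)
    with refl ← ⇓-deterministic p q = ⇓-deterministic p′ q′
  ⇓-deterministic {y = y} {z = z} (mu p below) (mu q below′) with <-cmp y z
  ... | tri≈ _ y≡z _ = y≡z
  ... | tri< y<z _ _ = ⊥-elim (0≢1+n (⇓-deterministic p (proj₂ (below′ _ y<z))))
  ... | tri> _ _ z<y = ⊥-elim (1+n≢0 (⇓-deterministic (proj₂ (below _ z<y)) q))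

  ⇓*-deterministic : ∀ {es : Vec (Rec n) m} {xs ys zs} →
                     es [ xs ]⇓* ys → es [ xs ]⇓* zs → ys ≡ zs
  ⇓*-deterministic [] [] = refl
  ⇓*-deterministic (p ∷ ps) (q ∷ qs) =
    cong₂ _∷_ (⇓-deterministic p q) (⇓*-deterministic ps qs)

_[_]↓ : Rec 1 → ℕ → Set
e [ i ]↓ = ∃[ y ] e [ i ∷ [] ]⇓ y

IsComputableSet : Pred ℕ 0ℓ → Set
IsComputableSet A = Σ (Rec 1) λ e → ∀ n →
  (A n × e [ n ∷ [] ]⇓ 1) ⊎ (¬ A n × e [ n ∷ [] ]⇓ 0)

IsCE : Pred ℕ 0ℓ → Set
IsCE W = Σ (Rec 1) λ e → ∀ n → W n ⇔ e [ n ]↓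

IsComputableOn : (A : Pred ℕ 0ℓ) → (∃ A → ℕ) → Set
IsComputableOn A f = Σ (Rec 1) λ e → ∀ x → e [ proj₁ x ∷ [] ]⇓ f x

infix 4 _⊆*_

-- A set of numbers is finite when it is bounded.

_⊆*_ : Pred ℕ 0ℓ → Pred ℕ 0ℓ → Set
A ⊆* B = InfinitelyOften.Fin (A ∖ B)

IsCohesive : Pred ℕ 0ℓ → Set₁
IsCohesive C = InfinitelyOften.Inf C × (∀ W → IsCE W → C ⊆* W ⊎ C ⊆* ∁ W)

record IsField (R : RawRing c ℓ) : Set (c ⊔ ℓ) where
  open RawRing R
  field
    isCommutativeRing : IsCommutativeRing _≈_ _+_ _*_ -_ 0# 1#
    1≉0               : 1# ≉ 0#
    inverse           : ∀ x → x ≉ 0# → ∃[ y ] x * y ≈ 1#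

  open IsCommutativeRing isCommutativeRing public

module Extension (F : RawRing c₁ ℓ₁) (K : RawRing c₂ ℓ₂)
                 (ι : RawRing.Carrier F → RawRing.Carrier K) where
  private
    module F = RawRing F
    module K = RawRing K

  -- Polynomials are coefficient lists, constant coefficient first; they
  -- may have leading zeros.

  Poly : Set c₁
  Poly = List F.Carrier

  NonZero : Poly → Set (c₁ ⊔ ℓ₁)
  NonZero = Any (F._≉ F.0#)

  eval : Poly → K.Carrier → K.Carrier
  eval []       x = K.0#
  eval (a ∷ as) x = ι a K.+ x K.* eval as x

  IsAlgebraicElement : K.Carrier → Set (c₁ ⊔ ℓ₁ ⊔ ℓ₂)
  IsAlgebraicElement x = ∃[ p ] NonZero p × eval p x K.≈ K.0#

  IsAlgebraic : Set (c₁ ⊔ ℓ₁ ⊔ c₂ ⊔ ℓ₂)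
  IsAlgebraic = ∀ x → IsAlgebraicElement x

  -- The monic polynomial with lower coefficients as, of degree length as.

  monic : List F.Carrier → Poly
  monic as = as ∷ʳ F.1#

  record MinimalPolynomial (x : K.Carrier) : Set (c₁ ⊔ ℓ₂) where
    field
      lower   : List F.Carrier
      root    : eval (monic lower) x K.≈ K.0#
      minimal : ∀ as → eval (monic as) x K.≈ K.0# → length lower ≤ length as

    degree : ℕ
    degree = length lower

  HasDegree : K.Carrier → ℕ → Set (c₁ ⊔ ℓ₂)
  HasDegree x d = Σ (MinimalPolynomial x) λ p → MinimalPolynomial.degree p ≡ d

-- An injective coding of pairs.

pair : ℕ → ℕ → ℕ
pair x y = (x Nat.+ y) Nat.* (x Nat.+ y) Nat.+ x

-- Closed terms in the language of rings with a constant for every element.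

data Term (X : Set) : Set where
  const   : X → Term X
  `0 `1   : Term X
  _`+_ _`*_ : Term X → Term X → Term X
  `-_     : Term X → Term X

⌜_⌝ : ∀ {A : Pred ℕ 0ℓ} → Term (∃ A) → ℕ
⌜ const a ⌝ = pair 0 (proj₁ a)
⌜ `0 ⌝      = pair 1 0
⌜ `1 ⌝      = pair 2 0
⌜ s `+ t ⌝  = pair 3 (pair ⌜ s ⌝ ⌜ t ⌝)
⌜ s `* t ⌝  = pair 4 (pair ⌜ s ⌝ ⌜ t ⌝)
⌜ `- t ⌝    = pair 5 ⌜ t ⌝

module _ (R : RawRing 0ℓ 0ℓ) where
  open RawRing R

  ⟦_⟧ : Term Carrier → Carrier
  ⟦ const a ⟧ = a
  ⟦ `0 ⟧      = 0#
  ⟦ `1 ⟧      = 1#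
  ⟦ s `+ t ⟧  = ⟦ s ⟧ + ⟦ t ⟧
  ⟦ s `* t ⟧  = ⟦ s ⟧ * ⟦ t ⟧
  ⟦ `- t ⟧    = - ⟦ t ⟧

module _ (A : Pred ℕ 0ℓ) (_⊕_ _⊗_ : ∃ A → ∃ A → ∃ A) (⊖_ : ∃ A → ∃ A)
         (𝟘 𝟙 : ∃ A) where

  -- The structure with domain A ⊆ ℕ; its equality is equality of numbers.

  subsetRing : RawRing 0ℓ 0ℓ
  subsetRing = record
    { Carrier = ∃ A
    ; _≈_     = _≡_ on proj₁
    ; _+_     = _⊕_
    ; _*_     = _⊗_
    ; -_      = ⊖_
    ; 0#      = 𝟘
    ; 1#      = 𝟙
    }

  -- The set of Gödel numbers of true closed equations.

  AtomicDiagram : Pred ℕ 0ℓ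
  AtomicDiagram n =
    ∃[ s ] ∃[ t ] n ≡ pair ⌜ s ⌝ ⌜ t ⌝ ×
                  proj₁ (⟦_⟧ subsetRing s) ≡ proj₁ (⟦_⟧ subsetRing t)

record ComputableField : Set₁ where
  field
    Dom     : Pred ℕ 0ℓ
    _⊕_ _⊗_ : ∃ Dom → ∃ Dom → ∃ Dom
    ⊖_      : ∃ Dom → ∃ Dom
    𝟘 𝟙     : ∃ Dom

  rawRing : RawRing 0ℓ 0ℓ
  rawRing = subsetRing Dom _⊕_ _⊗_ ⊖_ 𝟘 𝟙

  field
    isField           : IsField rawRing
    domainComputable  : IsComputableSet Dom
    diagramComputable : IsComputableSet (AtomicDiagram Dom _⊕_ _⊗_ ⊖_ 𝟘 𝟙)

  open RawRing rawRing public
  open IsField isField public using (+-cong; *-cong; -‿cong; 1≉0; inverse)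

record ComputableFieldExtension : Set₁ where
  field
    K F : ComputableField

  module K = ComputableField K
  module F = ComputableField F

  field
    Ψ                  : F.Carrier → K.Carrier
    Ψ-isHomomorphism   : RingMorphisms.IsRingHomomorphism F.rawRing K.rawRing Ψ
    Ψ-computable       : IsComputableOn F.Dom (proj₁ ∘ Ψ)

  open Extension F.rawRing K.rawRing Ψ public

-- A decision procedure for the atomic diagram computes the operations: a ⊕ b
-- is found by searching for the z for which the equation a + b = z is true.

module _ where
  open Nat using (_+_; _*_)

  addᵣ mulᵣ pairᵣ : Rec 2
  addᵣ = prec (proj zero) (comp suc (proj (suc zero) ∷ []))
  mulᵣ = prec (comp zero []) (comp addᵣ (proj (suc (suc zero)) ∷ proj (suc zero) ∷ []))
  pairᵣ = comp addᵣ (comp mulᵣ (addᵣ ∷ addᵣ ∷ []) ∷ proj zero ∷ [])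

  notᵣ : Rec 1
  notᵣ = prec (comp suc (zero ∷ [])) (comp zero [])

  constᵣ : ℕ → Rec n
  constᵣ zero    = comp zero []
  constᵣ (suc k) = comp suc (constᵣ k ∷ [])

  addᵣ⇓ : ∀ x y → addᵣ [ x ∷ y ∷ [] ]⇓ x + y
  addᵣ⇓ zero    y = prec0 proj
  addᵣ⇓ (suc x) y = precs (addᵣ⇓ x y) (comp (proj ∷ []) suc)

  mulᵣ⇓ : ∀ x y → mulᵣ [ x ∷ y ∷ [] ]⇓ x * y
  mulᵣ⇓ zero    y = prec0 (comp [] zero)
  mulᵣ⇓ (suc x) y = precs (mulᵣ⇓ x y) (comp (proj ∷ proj ∷ []) (addᵣ⇓ y (x * y)))

  pairᵣ⇓ : ∀ x y → pairᵣ [ x ∷ y ∷ [] ]⇓ pair x y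
  pairᵣ⇓ x y =
    comp (comp (addᵣ⇓ x y ∷ addᵣ⇓ x y ∷ []) (mulᵣ⇓ (x + y) (x + y)) ∷ proj ∷ [])
         (addᵣ⇓ ((x + y) * (x + y)) x)

  constᵣ⇓ : ∀ k {xs : Vec ℕ n} → constᵣ k [ xs ]⇓ k
  constᵣ⇓ zero    = comp [] zero
  constᵣ⇓ (suc k) = comp (constᵣ⇓ k ∷ []) suc

  notᵣ⇓0 : notᵣ [ 1 ∷ [] ]⇓ 0
  notᵣ⇓0 = precs (prec0 (comp (zero ∷ []) suc)) (comp [] zero)

  notᵣ⇓1 : notᵣ [ 0 ∷ [] ]⇓ 1
  notᵣ⇓1 = prec0 (comp (zero ∷ []) suc)

  proj* : (Fin m → Fin n) → Vec (Rec n) m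
  proj* f = tabulate (λ i → proj (f i))

  proj*⇓ : ∀ {k} (f : Fin k → Fin n) (xs : Vec ℕ n) →
           proj* f [ xs ]⇓* tabulate (lookup xs ∘ f)
  proj*⇓ {k = zero}  f xs = []
  proj*⇓ {k = suc k} f xs = proj ∷ proj*⇓ (λ i → f (suc i)) xs

  pair-< : ∀ x y x′ y′ → x + y < x′ + y′ → pair x y < pair x′ y′
  pair-< x y x′ y′ s<s′ = begin-strict
    s * s + x             ≤⟨ +-monoʳ-≤ (s * s) (m≤m+n x y) ⟩
    s * s + s             ≡⟨ +-comm (s * s) s ⟩
    s + s * s             <⟨ +-mono-<-≤ {s} {suc s} ≤-refl (*-mono-≤ {s} ≤-refl (n≤1+n s)) ⟩
    suc s * suc s         ≤⟨ *-mono-≤ s<s′ s<s′ ⟩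
    s′ * s′               ≤⟨ m≤m+n (s′ * s′) x′ ⟩
    s′ * s′ + x′          ∎
    where
    open ≤-Reasoning
    s = x + y
    s′ = x′ + y′

  pair-injective : ∀ x y x′ y′ → pair x y ≡ pair x′ y′ → x ≡ x′ × y ≡ y′
  pair-injective x y x′ y′ eq with <-cmp (x + y) (x′ + y′)
  ... | tri< s<s′ _ _ = ⊥-elim (<-irrefl eq (pair-< x y x′ y′ s<s′))
  ... | tri> _ _ s′<s = ⊥-elim (<-irrefl (sym eq) (pair-< x′ y′ x y s′<s))
  ... | tri≈ _ s≡s′ _ = x≡x′ , +-cancelˡ-≡ x y y′ (trans s≡s′ (cong (_+ y′) (sym x≡x′)))
    where
    x≡x′ : x ≡ x′
    x≡x′ = +-cancelˡ-≡ ((x + y) * (x + y)) x x′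
             (trans eq (cong (λ s → s * s + x′) (sym s≡s′)))

module FieldOperations (A : ComputableField) where
  open ComputableField A

  private
    value : Term Carrier → ℕ
    value t = proj₁ (⟦_⟧ rawRing t)

    tag body : Term Carrier → ℕ
    tag (const a) = 0
    tag `0        = 1
    tag `1        = 2
    tag (s `+ t)  = 3
    tag (s `* t)  = 4
    tag (`- t)    = 5
    body (const a) = proj₁ a
    body `0        = 0
    body `1        = 0
    body (s `+ t)  = pair ⌜ s ⌝ ⌜ t ⌝
    body (s `* t)  = pair ⌜ s ⌝ ⌜ t ⌝
    body (`- t)    = ⌜ t ⌝

    ⌜⌝-pair : ∀ t → ⌜ t ⌝ ≡ pair (tag t) (body t)
    ⌜⌝-pair (const a) = refl
    ⌜⌝-pair `0        = refl
    ⌜⌝-pair `1        = refl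
    ⌜⌝-pair (s `+ t)  = refl
    ⌜⌝-pair (s `* t)  = refl
    ⌜⌝-pair (`- t)    = refl

    ⌜⌝-injective : ∀ s t → ⌜ s ⌝ ≡ ⌜ t ⌝ → tag s ≡ tag t × body s ≡ body t
    ⌜⌝-injective s t eq = pair-injective (tag s) (body s) (tag t) (body t)
      (trans (sym (⌜⌝-pair s)) (trans eq (⌜⌝-pair t)))

    mutual
      ⌜⌝-value : ∀ s t → ⌜ s ⌝ ≡ ⌜ t ⌝ → value s ≡ value t
      ⌜⌝-value s t eq = tag-body-value s t (proj₁ inj) (proj₂ inj)
        where inj = ⌜⌝-injective s t eq

      tag-body-value : ∀ s t → tag s ≡ tag t → body s ≡ body t → value s ≡ value t
      tag-body-value (const a) (const b) refl eq = eq
      tag-body-value `0 `0 refl eq = refl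
      tag-body-value `1 `1 refl eq = refl
      tag-body-value (s `+ s′) (t `+ t′) refl eq =
        +-cong {⟦_⟧ rawRing s} {⟦_⟧ rawRing t} {⟦_⟧ rawRing s′} {⟦_⟧ rawRing t′}
               (⌜⌝-value s t (proj₁ inj)) (⌜⌝-value s′ t′ (proj₂ inj))
        where inj = pair-injective ⌜ s ⌝ ⌜ s′ ⌝ ⌜ t ⌝ ⌜ t′ ⌝ eq
      tag-body-value (s `* s′) (t `* t′) refl eq =
        *-cong {⟦_⟧ rawRing s} {⟦_⟧ rawRing t} {⟦_⟧ rawRing s′} {⟦_⟧ rawRing t′}
               (⌜⌝-value s t (proj₁ inj)) (⌜⌝-value s′ t′ (proj₂ inj))
        where inj = pair-injective ⌜ s ⌝ ⌜ s′ ⌝ ⌜ t ⌝ ⌜ t′ ⌝ eq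
      tag-body-value (`- s) (`- t) refl eq =
        -‿cong {⟦_⟧ rawRing s} {⟦_⟧ rawRing t} (⌜⌝-value s t eq)

    diagramᵣ : Rec 1
    diagramᵣ = proj₁ diagramComputable

    -- Tests whether the term computed by e on xs has value z, on input z ∷ xs.

    testᵣ : Rec n → Rec (suc n)
    testᵣ e = comp notᵣ (comp diagramᵣ (comp pairᵣ
      (comp e (proj* suc) ∷ comp pairᵣ (constᵣ 0 ∷ proj zero ∷ []) ∷ [])
      ∷ []) ∷ [])

    testᵣ⇓ : ∀ {e : Rec n} {xs k b b′} z → e [ xs ]⇓ k →
             diagramᵣ [ pair k (pair 0 z) ∷ [] ]⇓ b → notᵣ [ b ∷ [] ]⇓ b′ →
             testᵣ e [ z ∷ xs ]⇓ b′
    testᵣ⇓ {e = e} {xs} {k} z p q r =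
      comp (comp (comp (comp shifted p ∷ comp (constᵣ⇓ 0 ∷ proj ∷ []) (pairᵣ⇓ 0 z) ∷ [])
                       (pairᵣ⇓ k (pair 0 z)) ∷ [])
                 q ∷ []) r
      where
      shifted : proj* suc [ z ∷ xs ]⇓* xs
      shifted = subst (proj* suc [ z ∷ xs ]⇓*_) (tabulate∘lookup xs)
                      (proj*⇓ suc (z ∷ xs))

    valueᵣ : Rec n → Rec n
    valueᵣ e = mu (testᵣ e)

    valueᵣ⇓ : ∀ {e : Rec n} {xs} (t : Term Carrier) → e [ xs ]⇓ ⌜ t ⌝ → valueᵣ e [ xs ]⇓ value t
    valueᵣ⇓ {e = e} {xs} t p = mu found below
      where
      sound : ∀ z → AtomicDiagram Dom _⊕_ _⊗_ ⊖_ 𝟘 𝟙 (pair ⌜ t ⌝ (pair 0 z)) → z ≡ value t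
      sound z (s , s′ , eq , s≡s′) = trans (z≡s′ s′ (proj₂ inj)) (trans (sym s≡s′) (sym (⌜⌝-value t s (proj₁ inj))))
        where
        inj = pair-injective ⌜ t ⌝ (pair 0 z) ⌜ s ⌝ ⌜ s′ ⌝ eq
        z≡s′ : ∀ s′ → pair 0 z ≡ ⌜ s′ ⌝ → z ≡ value s′
        z≡s′ s′ eq = read s′ (proj₁ inj′) (proj₂ inj′)
          where
          inj′ = pair-injective 0 z (tag s′) (body s′) (trans eq (⌜⌝-pair s′))
          read : ∀ u → 0 ≡ tag u → z ≡ body u → z ≡ value u
          read (const a) refl eq = eq

      found : testᵣ e [ value t ∷ xs ]⇓ 0
      found with proj₂ diagramComputable (pair ⌜ t ⌝ (pair 0 (value t)))
      ... | inj₁ (_ , q) = testᵣ⇓ (value t) p q notᵣ⇓0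
      ... | inj₂ (¬d , _) = ⊥-elim (¬d (t , const (⟦_⟧ rawRing t) , refl , refl))

      below : ∀ z → z < value t → ∃[ k ] testᵣ e [ z ∷ xs ]⇓ suc k
      below z z<v with proj₂ diagramComputable (pair ⌜ t ⌝ (pair 0 z))
      ... | inj₁ (d , _) = ⊥-elim (<-irrefl (sound z d) z<v)
      ... | inj₂ (_ , q) = 0 , testᵣ⇓ z p q notᵣ⇓1

    binaryᵣ : ℕ → Rec 2
    binaryᵣ k = comp pairᵣ (constᵣ k ∷ comp pairᵣ
      ( comp pairᵣ (constᵣ 0 ∷ proj zero ∷ [])
      ∷ comp pairᵣ (constᵣ 0 ∷ proj (suc zero) ∷ []) ∷ []) ∷ [])

    binaryᵣ⇓ : ∀ k x y → binaryᵣ k [ x ∷ y ∷ [] ]⇓ pair k (pair (pair 0 x) (pair 0 y))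
    binaryᵣ⇓ k x y =
      comp (constᵣ⇓ k ∷ comp ( comp (constᵣ⇓ 0 ∷ proj ∷ []) (pairᵣ⇓ 0 x)
                             ∷ comp (constᵣ⇓ 0 ∷ proj ∷ []) (pairᵣ⇓ 0 y) ∷ [])
                             (pairᵣ⇓ (pair 0 x) (pair 0 y)) ∷ [])
           (pairᵣ⇓ k (pair (pair 0 x) (pair 0 y)))

    unaryᵣ : ℕ → Rec 1
    unaryᵣ k = comp pairᵣ (constᵣ k ∷ comp pairᵣ (constᵣ 0 ∷ proj zero ∷ []) ∷ [])

    unaryᵣ⇓ : ∀ k x → unaryᵣ k [ x ∷ [] ]⇓ pair k (pair 0 x)
    unaryᵣ⇓ k x = comp (constᵣ⇓ k ∷ comp (constᵣ⇓ 0 ∷ proj ∷ []) (pairᵣ⇓ 0 x) ∷ [])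
                       (pairᵣ⇓ k (pair 0 x))

  ⊕ᵣ ⊗ᵣ : Rec 2
  ⊕ᵣ = valueᵣ (binaryᵣ 3)
  ⊗ᵣ = valueᵣ (binaryᵣ 4)

  ⊖ᵣ : Rec 1
  ⊖ᵣ = valueᵣ (unaryᵣ 5)

  ⊕ᵣ⇓ : ∀ a b → ⊕ᵣ [ proj₁ a ∷ proj₁ b ∷ [] ]⇓ proj₁ (a ⊕ b)
  ⊕ᵣ⇓ a b = valueᵣ⇓ (const a `+ const b) (binaryᵣ⇓ 3 _ _)

  ⊗ᵣ⇓ : ∀ a b → ⊗ᵣ [ proj₁ a ∷ proj₁ b ∷ [] ]⇓ proj₁ (a ⊗ b)
  ⊗ᵣ⇓ a b = valueᵣ⇓ (const a `* const b) (binaryᵣ⇓ 4 _ _)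

  ⊖ᵣ⇓ : ∀ a → ⊖ᵣ [ proj₁ a ∷ [] ]⇓ proj₁ (⊖ a)
  ⊖ᵣ⇓ a = valueᵣ⇓ (`- const a) (unaryᵣ⇓ 5 _)

-- A representative φ of an element of the cohesive power: a partial
-- computable function from ω to A whose domain almost contains C.

record PartialElement (C A : Pred ℕ 0ℓ) : Set where
  field
    code     : Rec 1
    into     : ∀ {i y} → code [ i ∷ [] ]⇓ y → A y
    almostOn : C ⊆* code [_]↓

open PartialElement public

module _ {C : Pred ℕ 0ℓ} where

  infix 4 _≈ᶜ_

  _≈ᶜ_ : ∀ {A} → PartialElement C A → PartialElement C A → Set
  φ ≈ᶜ ψ = C ⊆* λ i → ∃[ y ] code φ [ i ∷ [] ]⇓ y × code ψ [ i ∷ [] ]⇓ y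

  constantᶜ : ∀ {A} → ∃ A → PartialElement C A
  constantᶜ {A} (a , a∈A) = record
    { code     = constᵣ a
    ; into     = λ p → subst A (⇓-deterministic (constᵣ⇓ a) p) a∈A
    ; almostOn = 0 , λ i _ (_ , ¬p) → ¬p (a , constᵣ⇓ a)
    }

  -- The pointwise application of a function f computed on its domain by e.

  map₁ : ∀ {A B} (f : ∃ A → ∃ B) (e : Rec 1) →
         (∀ a → e [ proj₁ a ∷ [] ]⇓ proj₁ (f a)) →
         PartialElement C A → PartialElement C B
  map₁ {B = B} f e e⇓ φ = record
    { code     = comp e (code φ ∷ [])
    ; into     = λ { (comp (p ∷ []) q) →
        subst B (⇓-deterministic (e⇓ (_ , into φ p)) q) (proj₂ (f (_ , into φ p))) }
    ; almostOn = proj₁ (almostOn φ) , λ i k≤i (i∈C , ¬p) →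
        proj₂ (almostOn φ) i k≤i (i∈C , λ (x , p) →
          ¬p (_ , comp (p ∷ []) (e⇓ (x , into φ p))))
    }

  map₂ : ∀ {A B D} (f : ∃ A → ∃ B → ∃ D) (e : Rec 2) →
         (∀ a b → e [ proj₁ a ∷ proj₁ b ∷ [] ]⇓ proj₁ (f a b)) →
         PartialElement C A → PartialElement C B → PartialElement C D
  map₂ {D = D} f e e⇓ φ ψ = record
    { code     = comp e (code φ ∷ code ψ ∷ [])
    ; into     = λ { (comp (p ∷ q ∷ []) r) →
        subst D (⇓-deterministic (e⇓ (_ , into φ p) (_ , into ψ q)) r)
                (proj₂ (f (_ , into φ p) (_ , into ψ q))) }
    ; almostOn = k Nat.⊔ l , λ i k⊔l≤i (i∈C , ¬r) →
        proj₂ (almostOn φ) i (≤-trans (m≤m⊔n k l) k⊔l≤i) (i∈C , λ (x , p) →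
        proj₂ (almostOn ψ) i (≤-trans (m≤n⊔m k l) k⊔l≤i) (i∈C , λ (y , q) →
          ¬r (_ , comp (p ∷ q ∷ []) (e⇓ (x , into φ p) (y , into ψ q)))))
    }
    where
    k = proj₁ (almostOn φ)
    l = proj₁ (almostOn ψ)

-- Elements are represented by partial computable functions, with _≈ᶜ_ as
-- the equality of the represented classes.

CohesivePower : Pred ℕ 0ℓ → ComputableField → RawRing 0ℓ 0ℓ
CohesivePower C A = record
  { Carrier = PartialElement C Dom
  ; _≈_     = _≈ᶜ_
  ; _+_     = map₂ _⊕_ ⊕ᵣ ⊕ᵣ⇓
  ; _*_     = map₂ _⊗_ ⊗ᵣ ⊗ᵣ⇓
  ; -_      = map₁ ⊖_ ⊖ᵣ ⊖ᵣ⇓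
  ; 0#      = constantᶜ 𝟘
  ; 1#      = constantᶜ 𝟙
  }
  where
  open ComputableField A
  open FieldOperations A

module CohesivePowerExtension (C : Pred ℕ 0ℓ) (E : ComputableFieldExtension) where
  open ComputableFieldExtension E

  ∏F ∏K : RawRing 0ℓ 0ℓ
  ∏F = CohesivePower C F
  ∏K = CohesivePower C K

  -- [α] ↦ [Ψ ∘ α]

  ∏Ψ : RawRing.Carrier ∏F → RawRing.Carrier ∏K
  ∏Ψ = map₁ Ψ (proj₁ Ψ-computable) (proj₂ Ψ-computable)

  open Extension ∏F ∏K ∏Ψ public

{-# OPTIONS --safe #-}

-- If deg ≤ N on K, every α ∈ K is a root of a monic polynomial of degree
-- exactly N (multiply the minimal polynomial by a power of X). Searching for
-- its coefficients is computable in α, so applying the search pointwise to φ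
-- gives a monic polynomial of degree N over ∏F that annihilates [φ].
--
-- If deg is unbounded, searching for elements of large degree gives a total
-- computable φ with deg (φ i) > i. A nonzero polynomial of length L over ∏F
-- that annihilates [φ] would at some i ≥ L specialise to a nonzero polynomial
-- of length L over F that annihilates φ i, although deg (φ i) > L.

module Submission where

open import Algebra.Bundles using (CommutativeRing)
open import Algebra.Bundles.Raw using (RawRing)
open import Algebra.Morphism.Structures using (module RingMorphisms)
open import Algebra.Structures using (IsCommutativeRing)
import Algebra.Properties.CommutativeSemigroup as CommutativeSemigroupProperties
open import Axiom.ExcludedMiddle using (ExcludedMiddle)
open import Data.Empty using (⊥-elim)
open import Data.Fin.Base using (zero; suc)
open import Data.List.Base using (List; []; _∷_; length)
open import Data.List.Membership.Propositional using (_∈_; find)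
open import Data.List.Relation.Binary.Pointwise using (Pointwise; []; _∷_; Pointwise-length)
open import Data.List.Relation.Unary.Any using (here; there; any?)
open import Data.List.Relation.Unary.Any.Properties using (++⁺ʳ)
open import Data.Nat.Base as Nat
  using (ℕ; zero; suc; _≤_; _<_; _⊔_; z≤n; s≤s; pred; _∸_; _≤′_; ≤′-refl; ≤′-step)
open import Data.Nat.Properties
  using ( <-cmp; <-irrefl; ≤-refl; ≤-trans; ≤-antisym; ≤-reflexive; ≤⇒≤′; ≰⇒>; <-trans; ≤-<-trans
        ; m≤m⊔n; m≤n⊔m; 0≢1+n; m≤m+n; m≤m*n; *-mono-≤; m+n∸m≡n; n∸n≡0
        ; m≤n⇒m∸n≡0; m∸n≡0⇒m≤n; m+n≡0⇒m≡0; m+n≡0⇒n≡0; pred[m∸n]≡m∸[1+n]; _≟_; _≤?_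
        ; module ≤-Reasoning)
  renaming (+-identityʳ to ℕ-+-identityʳ)
open import Data.Product.Base using (∃; ∃-syntax; _×_; _,_; proj₁; proj₂)
open import Data.Sum.Base using (inj₁; inj₂)
open import Data.Vec.Base using ([]; _∷_)
open import Function.Base using (_∘_; case_of_)
open import Function.Bundles using (_⇔_; mk⇔)
open import Level using (Level; 0ℓ)
open import Relation.Binary.Definitions using (Decidable; tri<; tri≈; tri>)
open import Relation.Binary.PropositionalEquality
  using (_≡_; refl; sym; trans; cong; cong₂; subst)
import Relation.Binary.Reasoning.Setoid as SetoidReasoning
open import Relation.Nullary.Decidable using (yes; no; ¬?)
open import Relation.Nullary.Negation using (¬_)
open import Relation.Unary using (Pred)
open import Defs

private
  variable
    n : ℕ
    c₁ ℓ₁ c₂ ℓ₂ : Level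
    C A : Pred ℕ 0ℓ

-- Polynomials

module _ {F : RawRing c₁ ℓ₁} {K : RawRing c₂ ℓ₂} {ι : RawRing.Carrier F → RawRing.Carrier K}
         (F-isField : IsField F)
         (K-isCommutativeRing : IsCommutativeRing (RawRing._≈_ K) (RawRing._+_ K) (RawRing._*_ K)
                                                  (RawRing.-_ K) (RawRing.0# K) (RawRing.1# K))
         (ι-isHomomorphism : RingMorphisms.IsRingHomomorphism F K ι) where

  open Extension F K ι
  private
    F-ring : CommutativeRing c₁ ℓ₁
    F-ring = record { isCommutativeRing = IsField.isCommutativeRing F-isField }
    K-ring : CommutativeRing c₂ ℓ₂
    K-ring = record { isCommutativeRing = K-isCommutativeRing }
    module F = CommutativeRing F-ring
    module K = CommutativeRing K-ring
  open K hiding (refl; trans; sym)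
  open RingMorphisms.IsRingHomomorphism ι-isHomomorphism
  open CommutativeSemigroupProperties *-commutativeSemigroup using (x∙yz≈y∙xz)
  open SetoidReasoning setoid

  eval-zero-shift : ∀ {a p x} → a F.≈ F.0# → eval p x ≈ 0# → eval (a ∷ p) x ≈ 0#
  eval-zero-shift {a} {p} {x} a≈0 p≈0 = begin
    ι a + x * eval p x ≈⟨ +-cong (K.trans (⟦⟧-cong a≈0) 0#-homo) (*-congˡ p≈0) ⟩
    0# + x * 0#        ≈⟨ +-congˡ (zeroʳ x) ⟩
    0# + 0#            ≈⟨ +-identityʳ 0# ⟩
    0#                 ∎

  -- A zero coefficient put in front multiplies by `X`: the polynomial stays monic, keeps its roots
  -- and gains one degree.
  monic-root-padded : ∀ {d N} (x : Carrier) → d ≤′ N →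
                      ∃[ as ] length as ≡ d × eval (monic as) x ≈ 0# →
                      ∃[ as ] length as ≡ N × eval (monic as) x ≈ 0#
  monic-root-padded x ≤′-refl root = root
  monic-root-padded x (≤′-step d≤N) root
    with as , |as|≡N , as≈0 ← monic-root-padded x d≤N root =
    F.0# ∷ as , cong suc |as|≡N , eval-zero-shift {p = monic as} F.refl as≈0

  module _ (_≟F_ : Decidable F._≈_) where

    eval-¬NonZero : ∀ p x → ¬ NonZero p → eval p x ≈ 0#
    eval-¬NonZero []      x _  = K.refl
    eval-¬NonZero (a ∷ p) x ¬nz with a ≟F F.0#
    ... | yes a≈0 = eval-zero-shift {p = p} a≈0 (eval-¬NonZero p x (¬nz ∘ there))
    ... | no  a≉0 = ⊥-elim (¬nz (here a≉0))

    -- `u` is the last nonzero entry of `p`: the zeros after it are dropped and the entries before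
    -- it are divided by `u`. The inequality is strict because `monic` appends the leading 1.
    monic-associate : ∀ p → NonZero p →
      ∃[ u ] ∃[ as ] ¬ u F.≈ F.0# × length as < length p ×
                     (∀ x → eval p x ≈ ι u * eval (monic as) x)
    monic-associate (a ∷ p) nz with any? (λ b → ¬? (b ≟F F.0#)) p
    ... | yes nz′ with u , as , u≉0 , |as|<|p| , p≈u*as ← monic-associate p nz′
                  with v , uv≈1 ← IsField.inverse F-isField u u≉0 =
      u , v F.* a ∷ as , u≉0 , s≤s |as|<|p| , λ x → begin
        ι a + x * eval p x
          ≈⟨ +-cong (⟦⟧-cong (F.sym (u[va]≈a v uv≈1))) (*-congˡ (p≈u*as x)) ⟩
        ι (u F.* (v F.* a)) + x * (ι u * eval (monic as) x)
          ≈⟨ +-cong (*-homo u (v F.* a)) (x∙yz≈y∙xz x (ι u) _) ⟩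
        ι u * ι (v F.* a) + ι u * (x * eval (monic as) x)
          ≈⟨ distribˡ (ι u) _ _ ⟨
        ι u * eval (monic (v F.* a ∷ as)) x ∎
      where
      u[va]≈a : ∀ v → u F.* v F.≈ F.1# → u F.* (v F.* a) F.≈ a
      u[va]≈a v uv≈1 =
        F.trans (F.sym (F.*-assoc u v a)) (F.trans (F.*-congʳ uv≈1) (F.*-identityˡ a))
    ... | no ¬nz′ = a , [] , a≉0 nz , s≤s z≤n , λ x → begin
        ι a + x * eval p x        ≈⟨ +-congˡ (*-congˡ (eval-¬NonZero p x ¬nz′)) ⟩
        ι a + x * 0#              ≈⟨ +-congˡ (zeroʳ x) ⟩
        ι a + 0#                  ≈⟨ +-identityʳ (ι a) ⟩
        ι a                       ≈⟨ *-identityʳ (ι a) ⟨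
        ι a * 1#                  ≈⟨ *-congˡ 1#-homo ⟨
        ι a * ι F.1#              ≈⟨ *-congˡ (+-identityʳ (ι F.1#)) ⟨
        ι a * (ι F.1# + 0#)       ≈⟨ *-congˡ (+-congˡ (zeroʳ x)) ⟨
        ι a * (ι F.1# + x * 0#)   ∎
      where
      a≉0 : NonZero (a ∷ p) → ¬ a F.≈ F.0#
      a≉0 (here a≉0)  = a≉0
      a≉0 (there nz′) = ⊥-elim (¬nz′ nz′)

    -- Minimality compares monic polynomials only, so an annihilator is first made monic; the
    -- inverse of `u` in `F` cancels `ι u`.
    shorter-monic-root : ∀ p x → NonZero p → eval p x ≈ 0# →
                         ∃[ as ] length as < length p × eval (monic as) x ≈ 0#
    shorter-monic-root p x nz p≈0
      with u , as , u≉0 , |as|<|p| , p≈u*as ← monic-associate p nz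
      with v , uv≈1 ← IsField.inverse F-isField u u≉0 =
      as , |as|<|p| , (begin
        m                   ≈⟨ *-identityˡ m ⟨
        1# * m              ≈⟨ *-congʳ 1#-homo ⟨
        ι F.1# * m          ≈⟨ *-congʳ (⟦⟧-cong (F.trans (F.*-comm v u) uv≈1)) ⟨
        ι (v F.* u) * m     ≈⟨ *-congʳ (*-homo v u) ⟩
        ι v * ι u * m       ≈⟨ *-assoc (ι v) (ι u) m ⟩
        ι v * (ι u * m)     ≈⟨ *-congˡ (p≈u*as x) ⟨
        ι v * eval p x      ≈⟨ *-congˡ p≈0 ⟩
        ι v * 0#            ≈⟨ zeroʳ (ι v) ⟩
        0#                  ∎)
      where m = eval (monic as) x

-- Computable functions

predᵣ : Rec 1
predᵣ = prec zero (proj zero)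

predᵣ⇓ : ∀ x → predᵣ [ x ∷ [] ]⇓ pred x
predᵣ⇓ zero    = prec0 zero
predᵣ⇓ (suc x) = precs (predᵣ⇓ x) proj

-- Recursion is on the first argument, so the subtrahend comes first.

flip-monusᵣ : Rec 2
flip-monusᵣ = prec (proj zero) (comp predᵣ (proj (suc zero) ∷ []))

flip-monusᵣ⇓ : ∀ y x → flip-monusᵣ [ y ∷ x ∷ [] ]⇓ x ∸ y
flip-monusᵣ⇓ zero    x = prec0 proj
flip-monusᵣ⇓ (suc y) x = precs (flip-monusᵣ⇓ y x)
  (comp (proj ∷ []) (subst (predᵣ [ x ∸ y ∷ [] ]⇓_) (pred[m∸n]≡m∸[1+n] x y) (predᵣ⇓ (x ∸ y))))

monusᵣ : Rec n → Rec n → Rec n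
monusᵣ e e′ = comp flip-monusᵣ (e′ ∷ e ∷ [])

monusᵣ⇓ : ∀ {e e′ : Rec n} {xs x y} → e [ xs ]⇓ x → e′ [ xs ]⇓ y →
          monusᵣ e e′ [ xs ]⇓ x ∸ y
monusᵣ⇓ p q = comp (q ∷ p ∷ []) (flip-monusᵣ⇓ _ _)

squareᵣ : Rec n → Rec n
squareᵣ e = comp mulᵣ (e ∷ e ∷ [])

squareᵣ⇓ : ∀ {e : Rec n} {xs x} → e [ xs ]⇓ x → squareᵣ e [ xs ]⇓ x Nat.* x
squareᵣ⇓ p = comp (p ∷ p ∷ []) (mulᵣ⇓ _ _)

-- Search for zeros and inversion of the pairing function.

module _ where
  open Nat using (_+_; _*_)

  -- Turns equality of numbers into a zero test, the form that `mu` can search for.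
  distance : ℕ → ℕ → ℕ
  distance x y = (x ∸ y) + (y ∸ x)

  distance≡0⇒≡ : ∀ x y → distance x y ≡ 0 → x ≡ y
  distance≡0⇒≡ x y d≡0 =
    ≤-antisym (m∸n≡0⇒m≤n (m+n≡0⇒m≡0 (x ∸ y) d≡0)) (m∸n≡0⇒m≤n (m+n≡0⇒n≡0 (x ∸ y) d≡0))

  ≡⇒distance≡0 : ∀ {x y} → x ≡ y → distance x y ≡ 0
  ≡⇒distance≡0 {x} refl = cong₂ _+_ (n∸n≡0 x) (n∸n≡0 x)

  distanceᵣ : Rec n → Rec n → Rec n
  distanceᵣ e e′ = comp addᵣ (monusᵣ e e′ ∷ monusᵣ e′ e ∷ [])

  distanceᵣ⇓ : ∀ {e e′ : Rec n} {xs x y} → e [ xs ]⇓ x → e′ [ xs ]⇓ y →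
               distanceᵣ e e′ [ xs ]⇓ distance x y
  distanceᵣ⇓ p q = comp (monusᵣ⇓ p q ∷ monusᵣ⇓ q p ∷ []) (addᵣ⇓ _ _)

  -- Mirrors the premises of the rule `mu`, where the values before the first zero are given as
  -- successors.
  LeastZero : (ℕ → ℕ) → Pred ℕ 0ℓ
  LeastZero f s = f s ≡ 0 × (∀ z → z < s → ∃[ k ] f z ≡ suc k)

  leastZero : ∀ f → ∃[ s ] f s ≡ 0 → ∃[ s ] LeastZero f s
  leastZero f (s , fs≡0) = search f s fs≡0
    where
    search : ∀ f s → f s ≡ 0 → ∃[ s ] LeastZero f s
    search f s fs≡0 with f 0 in f0≡
    ... | zero = 0 , f0≡ , λ _ ()
    search f zero    fs≡0 | suc k = ⊥-elim (0≢1+n (trans (sym fs≡0) f0≡))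
    search f (suc s) fs≡0 | suc k with t , ft≡0 , below ← search (f ∘ suc) s fs≡0 =
      suc t , ft≡0 , λ { zero _ → k , f0≡ ; (suc z) (s≤s z<t) → below z z<t }

  mu⇓ : ∀ {e : Rec (suc n)} {xs f s} → (∀ z → e [ z ∷ xs ]⇓ f z) → LeastZero f s →
        mu e [ xs ]⇓ s
  mu⇓ {e = e} {xs} {s = s} e⇓ (fs≡0 , below) =
    mu (subst (e [ s ∷ xs ]⇓_) fs≡0 (e⇓ s))
       λ z z<s → case below z z<s of λ (k , fz≡) → k , subst (e [ z ∷ xs ]⇓_) fz≡ (e⇓ z)

  -- pair x y lies between (x + y)² and (x + y + 1)², so the integer square
  -- root recovers x + y.

  leastRoot : ∀ n → ∃[ s ] LeastZero (λ s → suc n ∸ suc s * suc s) s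
  leastRoot n = leastZero _ (n , m≤n⇒m∸n≡0 (m≤m*n (suc n) (suc n)))

  √ : ℕ → ℕ
  √ = proj₁ ∘ leastRoot

  √-pair : ∀ x y → √ (pair x y) ≡ x + y
  √-pair x y with s , excess≡0 , below ← leastRoot (pair x y) with <-cmp s (x + y)
  ... | tri≈ _ s≡x+y _ = s≡x+y
  ... | tri< s<x+y _ _ = ⊥-elim (<-irrefl refl (begin-strict
    pair x y             <⟨ m∸n≡0⇒m≤n excess≡0 ⟩
    suc s * suc s        ≤⟨ *-mono-≤ s<x+y s<x+y ⟩
    (x + y) * (x + y)    ≤⟨ m≤m+n _ x ⟩
    pair x y             ∎))
    where open ≤-Reasoning
  ... | tri> _ _ x+y<s with k , excess≡ ← below (x + y) x+y<s =
    ⊥-elim (0≢1+n (trans (sym (m≤n⇒m∸n≡0 pair<)) excess≡))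
    where
    pair< : pair x y < suc (x + y) * suc (x + y)
    pair< = subst (pair x y <_) (ℕ-+-identityʳ _) (pair-< x y 0 (suc (x + y)) ≤-refl)

  unpair₁ unpair₂ : ℕ → ℕ
  unpair₁ n = n ∸ √ n * √ n
  unpair₂ n = √ n ∸ unpair₁ n

  unpair₁-pair : ∀ x y → unpair₁ (pair x y) ≡ x
  unpair₁-pair x y =
    trans (cong (λ s → pair x y ∸ s * s) (√-pair x y)) (m+n∸m≡n ((x + y) * (x + y)) x)

  unpair₂-pair : ∀ x y → unpair₂ (pair x y) ≡ y
  unpair₂-pair x y =
    trans (cong₂ _∸_ (√-pair x y) (unpair₁-pair x y)) (m+n∸m≡n x y)

  √ᵣ unpair₁ᵣ unpair₂ᵣ : Rec 1
  √ᵣ = mu (monusᵣ (comp suc (proj (suc zero) ∷ [])) (squareᵣ (comp suc (proj zero ∷ []))))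
  unpair₁ᵣ = monusᵣ (proj zero) (squareᵣ √ᵣ)
  unpair₂ᵣ = monusᵣ √ᵣ unpair₁ᵣ

  √ᵣ⇓ : ∀ n → √ᵣ [ n ∷ [] ]⇓ √ n
  √ᵣ⇓ n = mu⇓ (λ s → monusᵣ⇓ (comp (proj ∷ []) suc) (squareᵣ⇓ (comp (proj ∷ []) suc)))
              (proj₂ (leastRoot n))

  unpair₁ᵣ⇓ : ∀ n → unpair₁ᵣ [ n ∷ [] ]⇓ unpair₁ n
  unpair₁ᵣ⇓ n = monusᵣ⇓ proj (squareᵣ⇓ (√ᵣ⇓ n))

  unpair₂ᵣ⇓ : ∀ n → unpair₂ᵣ [ n ∷ [] ]⇓ unpair₂ n
  unpair₂ᵣ⇓ n = monusᵣ⇓ (√ᵣ⇓ n) (unpair₁ᵣ⇓ n)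

-- A computable retraction of ℕ onto a computable set: the field operations may
-- diverge off their domain, so searches have to range over its image.

module Retraction (A-computable : IsComputableSet A) (a₀ : ∃ A) where

  retract : ℕ → ∃ A
  retract n with proj₂ A-computable n
  ... | inj₁ (n∈A , _) = n , n∈A
  ... | inj₂ _         = a₀

  retract-∈ : ∀ a → proj₁ (retract (proj₁ a)) ≡ proj₁ a
  retract-∈ (n , n∈A) with proj₂ A-computable n
  ... | inj₁ _         = refl
  ... | inj₂ (n∉A , _) = ⊥-elim (n∉A n∈A)

  -- Primitive recursion on the output of the decision procedure acts as a case distinction: 0
  -- selects `a₀`, 1 selects the input itself.
  retractᵣ : Rec 1
  retractᵣ = comp (prec (constᵣ (proj₁ a₀)) (proj (suc (suc zero))))
                  (proj₁ A-computable ∷ proj zero ∷ [])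

  retractᵣ⇓ : ∀ n → retractᵣ [ n ∷ [] ]⇓ proj₁ (retract n)
  retractᵣ⇓ n with proj₂ A-computable n
  ... | inj₁ (_ , p) = comp (p ∷ proj ∷ []) (precs (prec0 (constᵣ⇓ _)) proj)
  ... | inj₂ (_ , p) = comp (p ∷ proj ∷ []) (prec0 (constᵣ⇓ _))

-- Elements of the cohesive power at an index

_[_]≔_ : PartialElement C A → ℕ → ∃ A → Set
φ [ i ]≔ a = code φ [ i ∷ [] ]⇓ proj₁ a

-- The maximum of the finitely many bounds works for all entries at once. The double negation comes
-- from `⊆*`, which only refutes divergence on `C` beyond a bound.
values-defined : (p : List (PartialElement C A)) →
  ∃[ k ] ∀ i → k ≤ i → C i → ¬ ¬ (∃[ as ] Pointwise (_[ i ]≔_) p as)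
values-defined []      = 0 , λ i _ _ ¬as → ¬as ([] , [])
values-defined (φ ∷ p) with k , p↓ ← values-defined p =
  l ⊔ k , λ i l⊔k≤i i∈C ¬as →
    proj₂ (almostOn φ) i (≤-trans (m≤m⊔n l k) l⊔k≤i) (i∈C , λ (y , φ⇓y) →
    p↓ i (≤-trans (m≤n⊔m l k) l⊔k≤i) i∈C λ (as , p≔as) →
      ¬as ((y , into φ φ⇓y) ∷ as , φ⇓y ∷ p≔as))
  where l = proj₁ (almostOn φ)

module _ (E : ComputableFieldExtension) {C : Pred ℕ 0ℓ} where
  open ComputableFieldExtension E
  private
    module ∏ = CohesivePowerExtension C E
    module Kᵣ = FieldOperations K
    module FR = Retraction F.domainComputable F.𝟘
    module KR = Retraction K.domainComputable K.𝟘

    Ψᵣ : Rec 1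
    Ψᵣ = proj₁ Ψ-computable
    Ψᵣ⇓ = proj₂ Ψ-computable

    K-isCommutativeRing = IsField.isCommutativeRing K.isField

  -- The operations of the power compose programs, so evaluation over the power specialises at each
  -- index where the coefficients and `φ` halt.
  eval-at : ∀ {i p as φ x} → Pointwise (_[ i ]≔_) p as → φ [ i ]≔ x →
            ∏.eval p φ [ i ]≔ eval as x
  eval-at [] φ≔x = constᵣ⇓ _
  eval-at {as = a ∷ as} {x = x} (f≔a ∷ p≔as) φ≔x =
    comp (comp (f≔a ∷ []) (Ψᵣ⇓ a) ∷
          comp (φ≔x ∷ eval-at p≔as φ≔x ∷ []) (Kᵣ.⊗ᵣ⇓ x (eval as x)) ∷ [])
         (Kᵣ.⊕ᵣ⇓ (Ψ a) (x K.⊗ eval as x))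

  NonZero-at : ∀ {i as f} {p : List (PartialElement C F.Dom)} → Pointwise (_[ i ]≔_) p as → f ∈ p →
               ¬ (∃[ y ] code f [ i ∷ [] ]⇓ y × constᵣ (proj₁ F.𝟘) [ i ∷ [] ]⇓ y) → NonZero as
  NonZero-at {i} (f≔a ∷ _) (here refl) f≉0 = here λ a≈0 →
    f≉0 (_ , f≔a , subst (constᵣ (proj₁ F.𝟘) [ i ∷ [] ]⇓_) (sym a≈0) (constᵣ⇓ _))
  NonZero-at (_ ∷ p≔as) (there f∈p) f≉0 = there (NonZero-at p≔as f∈p f≉0)

  module _ (C-infinite : ¬ (∃[ k ] ∀ i → k ≤ i → ¬ C i)) where

    -- The two constants differ at every index, so almost equality on `C` would bound `C`.
    1≉ᶜ0 : ¬ RawRing._≈_ ∏.∏F (RawRing.1# ∏.∏F) (RawRing.0# ∏.∏F)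
    1≉ᶜ0 (k , 1≈0) = C-infinite (k , λ i k≤i i∈C → 1≈0 i k≤i (i∈C , λ (y , p , q) →
      F.1≉0 (trans (⇓-deterministic (constᵣ⇓ _) p) (⇓-deterministic q (constᵣ⇓ _)))))

  -- Coding of monic polynomials of a fixed degree by numbers.

  decode : ℕ → ℕ → List F.Carrier
  decode zero    n = []
  -- The retraction makes every number a valid code, so a search over codes never gets stuck.
  decode (suc N) n = FR.retract (unpair₁ n) ∷ decode N (unpair₂ n)

  encode : List F.Carrier → ℕ
  encode []       = 0
  encode (a ∷ as) = pair (proj₁ a) (encode as)

  -- Decoding recovers the coefficients as numbers, but possibly with other proofs of membership in
  -- the domain; hence values are compared instead of lists.
  eval-decode-encode : ∀ as x →
    eval (monic (decode (length as) (encode as))) x K.≈ eval (monic as) x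
  eval-decode-encode []       x = refl
  eval-decode-encode (a ∷ as) x =
    K.+-cong {Ψ a′} {Ψ a} {x K.⊗ m (unpair₂ q)} {x K.⊗ eval (monic as) x}
      (⟦⟧-cong {a′} {a} (trans (cong (proj₁ ∘ FR.retract) (unpair₁-pair (proj₁ a) (encode as)))
                               (FR.retract-∈ a)))
      (K.*-cong {x} {x} {m (unpair₂ q)} {eval (monic as) x} refl
        (trans (cong (proj₁ ∘ m) (unpair₂-pair (proj₁ a) (encode as))) (eval-decode-encode as x)))
    where
    open RingMorphisms.IsRingHomomorphism Ψ-isHomomorphism using (⟦⟧-cong)
    q  = pair (proj₁ a) (encode as)
    a′ = FR.retract (unpair₁ q)
    m : ℕ → K.Carrier
    m k = eval (monic (decode (length as) k)) x

  -- Horner's scheme unrolled into one program for each `N`; the code of the polynomial and the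
  -- point are its inputs.
  eval-decodeᵣ : ℕ → Rec 2
  eval-decodeᵣ zero = comp Kᵣ.⊕ᵣ
    (constᵣ (proj₁ (Ψ F.𝟙)) ∷ comp Kᵣ.⊗ᵣ (proj (suc zero) ∷ constᵣ (proj₁ K.𝟘) ∷ []) ∷ [])
  eval-decodeᵣ (suc N) = comp Kᵣ.⊕ᵣ
    ( comp Ψᵣ (comp FR.retractᵣ (comp unpair₁ᵣ (proj zero ∷ []) ∷ []) ∷ [])
    ∷ comp Kᵣ.⊗ᵣ (proj (suc zero)
        ∷ comp (eval-decodeᵣ N) (comp unpair₂ᵣ (proj zero ∷ []) ∷ proj (suc zero) ∷ []) ∷ [])
    ∷ [])

  eval-decodeᵣ⇓ : ∀ N n x →
    eval-decodeᵣ N [ n ∷ proj₁ x ∷ [] ]⇓ proj₁ (eval (monic (decode N n)) x)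
  eval-decodeᵣ⇓ zero n x =
    comp (constᵣ⇓ _ ∷ comp (proj ∷ constᵣ⇓ _ ∷ []) (Kᵣ.⊗ᵣ⇓ x K.𝟘) ∷ [])
         (Kᵣ.⊕ᵣ⇓ (Ψ F.𝟙) (x K.⊗ K.𝟘))
  eval-decodeᵣ⇓ (suc N) n x =
    comp ( comp (comp (comp (proj ∷ []) (unpair₁ᵣ⇓ n) ∷ []) (FR.retractᵣ⇓ (unpair₁ n)) ∷ [])
                (Ψᵣ⇓ a)
         ∷ comp (proj ∷ comp (comp (proj ∷ []) (unpair₂ᵣ⇓ n) ∷ proj ∷ [])
                             (eval-decodeᵣ⇓ N (unpair₂ n) x) ∷ [])
                (Kᵣ.⊗ᵣ⇓ x m)
         ∷ [])
         (Kᵣ.⊕ᵣ⇓ (Ψ a) (x K.⊗ m))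
    where
    a = FR.retract (unpair₁ n)
    m = eval (monic (decode N (unpair₂ n))) x

  -- Wherever `φ` takes a value `x`, the entries take the values in `decode N (g x)`. Passing from
  -- `g` to `unpair₂ ∘ g` makes each coefficient a program applied to `φ`.
  decodeᶜ : (N : ℕ) (g : K.Carrier → ℕ) (e : Rec 1) → (∀ x → e [ proj₁ x ∷ [] ]⇓ g x) →
            PartialElement C K.Dom → List (PartialElement C F.Dom)
  decodeᶜ zero    g e e⇓ φ = []
  decodeᶜ (suc N) g e e⇓ φ =
    map₁ (FR.retract ∘ unpair₁ ∘ g) (comp FR.retractᵣ (comp unpair₁ᵣ (e ∷ []) ∷ []))
         (λ x → comp (comp (e⇓ x ∷ []) (unpair₁ᵣ⇓ _) ∷ []) (FR.retractᵣ⇓ _)) φ ∷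
    decodeᶜ N (unpair₂ ∘ g) (comp unpair₂ᵣ (e ∷ [])) (λ x → comp (e⇓ x ∷ []) (unpair₂ᵣ⇓ _)) φ

  monic-decodeᶜ-at : ∀ N g e e⇓ {φ i x} → φ [ i ]≔ x →
    Pointwise (_[ i ]≔_) (∏.monic (decodeᶜ N g e e⇓ φ)) (monic (decode N (g x)))
  monic-decodeᶜ-at zero    g e e⇓ φ≔x = constᵣ⇓ _ ∷ []
  monic-decodeᶜ-at (suc N) g e e⇓ {x = x} φ≔x =
    comp (φ≔x ∷ []) (comp (comp (e⇓ x ∷ []) (unpair₁ᵣ⇓ _) ∷ []) (FR.retractᵣ⇓ _)) ∷
    monic-decodeᶜ-at N _ _ _ φ≔x

  -- Bounds on the degree and algebraicity of the power.

  module _ (deg : K.Carrier → ℕ) (hasDegree : ∀ x → HasDegree x (deg x)) where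

    bounded⇒algebraic : ¬ (∃[ k ] ∀ i → k ≤ i → ¬ C i) →
                        ∃[ N ] (∀ x → deg x ≤ N) → ∏.IsAlgebraic
    bounded⇒algebraic C-infinite (N , deg≤N) φ =
      -- The appended leading coefficient 1 witnesses that the polynomial is nonzero.
      ∏.monic as , ++⁺ʳ as (here (1≉ᶜ0 C-infinite)) ,
      (proj₁ (almostOn φ) , λ i k≤i (i∈C , ¬0) →
        proj₂ (almostOn φ) i k≤i (i∈C , λ (y , φ⇓y) → let x = y , into φ φ⇓y in
          ¬0 (_ , eval-at {φ = φ} (monic-decodeᶜ-at N index indexᵣ indexᵣ⇓ {φ} {x = x} φ⇓y) φ⇓y ,
              subst (constᵣ (proj₁ K.𝟘) [ i ∷ [] ]⇓_)
                    (sym (distance≡0⇒≡ _ _ (proj₁ (proj₂ (leastIndex x))))) (constᵣ⇓ _))))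
      where
      distance-from-0 : K.Carrier → ℕ → ℕ
      distance-from-0 x n = distance (proj₁ (eval (monic (decode N n)) x)) (proj₁ K.𝟘)

      -- Guarantees that the search for a code in degree exactly `N` terminates at every `x`.
      monic-root : ∀ x → ∃[ as ] length as ≡ N × eval (monic as) x K.≈ K.𝟘
      monic-root x with p , |p|≡deg ← hasDegree x =
        monic-root-padded F.isField K-isCommutativeRing Ψ-isHomomorphism x (≤⇒≤′ (deg≤N x))
          (lower , |p|≡deg , root)
        where open MinimalPolynomial p

      leastIndex : ∀ x → ∃[ n ] LeastZero (distance-from-0 x) n
      leastIndex x with as , refl , as≈0 ← monic-root x =
        leastZero (distance-from-0 x)
          (encode as , ≡⇒distance≡0 (trans (eval-decode-encode as x) as≈0))

      index : K.Carrier → ℕ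
      index = proj₁ ∘ leastIndex

      indexᵣ : Rec 1
      indexᵣ = mu (distanceᵣ (eval-decodeᵣ N) (constᵣ (proj₁ K.𝟘)))

      indexᵣ⇓ : ∀ x → indexᵣ [ proj₁ x ∷ [] ]⇓ index x
      indexᵣ⇓ x = mu⇓ (λ n → distanceᵣ⇓ (eval-decodeᵣ⇓ N n x) (constᵣ⇓ _)) (proj₂ (leastIndex x))

      as : List (PartialElement C F.Dom)
      as = decodeᶜ N index indexᵣ indexᵣ⇓ φ

    -- A list of length `L` has degree at most `L - 1`, which makes the bound strict.
    deg<length : ∀ p x → NonZero p → eval p x K.≈ K.𝟘 → deg x < length p
    deg<length p x nz p≈0
      with as , |as|<|p| , as≈0 ← shorter-monic-root F.isField K-isCommutativeRing Ψ-isHomomorphism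
                                    (λ a b → proj₁ a ≟ proj₁ b) p x nz p≈0
      with q , |q|≡deg ← hasDegree x =
      ≤-<-trans (subst (_≤ length as) |q|≡deg (MinimalPolynomial.minimal q as as≈0)) |as|<|p|

    element-of-large-degrees : IsComputableOn K.Dom deg → (∀ i → ∃[ x ] i < deg x) →
      ∃[ φ ] ∀ i → ∃[ x ] (_[_]≔_ {C = C} {K.Dom} φ i x) × i < deg x
    element-of-large-degrees (degᵣ , degᵣ⇓) large = φ , λ i →
      value i , φ⇓ i , m∸n≡0⇒m≤n (proj₁ (proj₂ (leastIndex i)))
      where
      excess : ℕ → ℕ → ℕ
      -- With `suc i`, a zero excess means that the degree is strictly above `i`.
      excess i z = suc i ∸ deg (KR.retract z)

      -- The program for `deg` sees only the number, so the degree cannot depend on the proof of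
      -- membership.
      deg-cong : ∀ x y → x K.≈ y → deg x ≡ deg y
      deg-cong x y x≈y = ⇓-deterministic (degᵣ⇓ x)
        (subst (λ z → degᵣ [ z ∷ [] ]⇓ deg y) (sym x≈y) (degᵣ⇓ y))

      leastIndex : ∀ i → ∃[ z ] LeastZero (excess i) z
      leastIndex i with x , i<deg ← large i =
        leastZero (excess i) (proj₁ x , m≤n⇒m∸n≡0
          (≤-trans i<deg (≤-reflexive (deg-cong x _ (sym (KR.retract-∈ x))))))

      value : ℕ → K.Carrier
      value i = KR.retract (proj₁ (leastIndex i))

      φᵣ : Rec 1
      φᵣ = comp KR.retractᵣ (mu (monusᵣ (comp suc (proj (suc zero) ∷ []))
                                        (comp degᵣ (comp KR.retractᵣ (proj zero ∷ []) ∷ []))) ∷ [])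

      φ⇓ : ∀ i → φᵣ [ i ∷ [] ]⇓ proj₁ (value i)
      φ⇓ i = comp (mu⇓ (λ z → monusᵣ⇓ (comp (proj ∷ []) suc)
                                (comp (comp (proj ∷ []) (KR.retractᵣ⇓ z) ∷ []) (degᵣ⇓ _)))
                       (proj₂ (leastIndex i)) ∷ [])
                  (KR.retractᵣ⇓ _)

      φ : PartialElement C K.Dom
      φ = record
        { code     = φᵣ
        ; into     = λ {i} p → subst K.Dom (⇓-deterministic (φ⇓ i) p) (proj₂ (value i))
        ; almostOn = 0 , λ i _ (_ , ¬φ↓) → ¬φ↓ (_ , φ⇓ i)
        }

    unbounded⇒¬algebraic : IsComputableOn K.Dom deg → (∀ i → ∃[ x ] i < deg x) →
                           ¬ ∏.IsAlgebraic
    unbounded⇒¬algebraic deg-computable large algebraic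
      with φ , φ≔ ← element-of-large-degrees deg-computable large
      with p , nz , l , p≈0 ← algebraic φ
      with f , f∈p , f≉0 ← find nz
      with k , p↓ ← values-defined p =
      -- It suffices that the nonzero coefficient `f` vanishes almost everywhere on `C`. Beyond `k`
      -- the coefficients are defined up to double negation, beyond `l` the relation holds up to
      -- double negation, and `length p` bounds the degree of `φ i`. Each goal is a contradiction,
      -- so the double negations can be eliminated.
      f≉0 (k ⊔ (l ⊔ length p) , λ i b≤i (i∈C , ¬f≈0) →
        p↓ i (≤-trans (m≤m⊔n k _) b≤i) i∈C λ (as , p≔as) →
        p≈0 i (≤-trans (m≤m⊔n l _) (≤-trans (m≤n⊔m k _) b≤i)) (i∈C , λ (y , p⇓y , 0⇓y) →
        let x , φ≔x , i<deg = φ≔ i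
            as≈0 = trans (⇓-deterministic (eval-at {φ = φ} p≔as φ≔x) p⇓y)
                         (⇓-deterministic 0⇓y (constᵣ⇓ _))
            deg<|as| = deg<length as x (NonZero-at p≔as f∈p ¬f≈0) as≈0
            |p|≤i = ≤-trans (m≤n⊔m l _) (≤-trans (m≤n⊔m k _) b≤i)
        -- The contradictory chain is `length p ≤ i < deg x < length as = length p`.
        in <-irrefl refl (≤-<-trans |p|≤i
             (subst (i <_) (sym (Pointwise-length p≔as)) (<-trans i<deg deg<|as|)))))

corollary4p9 : ExcludedMiddle 0ℓ →
    (E : ComputableFieldExtension) → let open ComputableFieldExtension E in
    IsAlgebraic →
    (deg : K.Carrier → ℕ) → (∀ α → HasDegree α (deg α)) →
    IsComputableOn K.Dom deg →
    (C : Pred ℕ 0ℓ) → IsCohesive C →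
    CohesivePowerExtension.IsAlgebraic C E ⇔ (∃[ N ] ∀ α → deg α ≤ N)
corollary4p9 em E _ deg hasDegree deg-computable C (C-infinite , _) =
  mk⇔ algebraic⇒bounded (bounded⇒algebraic E deg hasDegree C-infinite)
  where
  open ComputableFieldExtension E

  algebraic⇒bounded : CohesivePowerExtension.IsAlgebraic C E → ∃[ N ] ∀ α → deg α ≤ N
  algebraic⇒bounded algebraic with em {∃[ N ] ∀ α → deg α ≤ N}
  ... | yes bounded  = bounded
  ... | no unbounded = ⊥-elim (unbounded⇒¬algebraic E deg hasDegree deg-computable large algebraic)
    where
    -- These classically obtained witnesses only ensure that the search halts; the element of the
    -- power is computed by the search itself.
    large : ∀ i → ∃[ α ] i < deg α
    large i with em {∃[ α ] i < deg α}
    ... | yes above = above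
    ... | no ¬above = ⊥-elim (unbounded (i , λ α → case deg α ≤? i of λ
      { (yes deg≤i) → deg≤i ; (no deg≰i) → ⊥-elim (¬above (α , ≰⇒> deg≰i)) }))
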